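{- Let $\mathcal{M}=((X,\mathcal{C}),\mathcal{V})$ be a quasi-discrete closure model, $x\in X$, and $\phi_1,\phi_2$ SLCS formulas. Then $\mathcal{M},x\models\phi_1\,\mathcal{S}\,\phi_2$ (path-based semantics) if and only if there exists $A\subseteq X$ with $x\in A$ such that $\mathcal{M},y\models\phi_1$ for all $y\in A$ and $\mathcal{M},z\models\phi_2$ for all $z\in\mathcal{C}(A)\setminus A$.
   Context: A closure space is $(X,\mathcal{C})$ with $\mathcal{C}:\wp(X)\to\wp(X)$, $\mathcal{C}(\emptyset)=\emptyset$, $A\subseteq\mathcal{C}(A)$, $\mathcal{C}(A\cup B)=\mathcal{C}(A)\cup\mathcal{C}(B)$. It is quasi-discrete if there is $R\subseteq X\times X$ with $\mathcal{C}=\mathcal{C}_R$, where $\mathcal{C}_R(A)=A\cup\{x\mid\exists a\in A.(a,x)\in R\}$ (equivalently, $\mathcal{C}(A)=\bigcup_{a\in A}\mathcal{C}(\{a\})$ for all $A$). A function between closure spaces is continuous if $f(\mathcal{C}_1(A))\subseteq\mathcal{C}_2(f(A))$. Paths in a quasi-discrete space are continuous functions $p:(\mathbb{N},\mathcal{C}_\succ)\to(X,\mathcal{C})$ where $\succ=\{(n,n+1)\mid n\in\mathbb{N}\}$. A quasi-discrete closure model is $\mathcal{M}=((X,\mathcal{C}),\mathcal{V})$ with $(X,\mathcal{C})$ quasi-discrete and $\mathcal{V}:AP\to 2^X$. SLCS formulas: $\Phi::=a\mid\top\mid\lnot\Phi\mid\Phi\land\Phi\mid\mathcal{N}\Phi\mid\Phi\,\mathcal{S}\,\Phi\mid\Phi\rightsquigarrow\Phi$,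 with semantics: $x\models a$ iff $x\in\mathcal{V}(a)$; boolean connectives as usual; $x\models\mathcal{N}\phi$ iff $x\in\mathcal{C}(\{y\mid y\models\phi\})$; $x\models\phi_1\,\mathcal{S}\,\phi_2$ iff $x\models\phi_1$ and for every path $p$ with $p(0)=x$ and every $l\in\mathbb{N}$, if $p(l)\models\lnot\phi_1$ then there is $k$ with $0<k\le l$ and $p(k)\models\phi_2$; $x\models\phi_1\rightsquigarrow\phi_2$ iff $x\models\phi_2$ and there exist $y$, a path $p$ and $l$ with $p(0)=y$, $p(l)=x$, $y\models\phi_1$ and $p(i)\models\phi_2$ for all $0<i<l$. -}

module Defs where

open import Level using (Level; 0ℓ; _⊔_; Lift) renaming (suc to lsuc)
open import Data.Nat.Base using (ℕ; suc; _<_; _≤_)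
open import Data.Product using (Σ-syntax; ∃-syntax; _×_; _,_)
open import Data.Sum using (inj₁; inj₂)
open import Data.Unit.Polymorphic using (⊤)
open import Relation.Binary.Core using (Rel)
open import Relation.Binary.PropositionalEquality using (_≡_)
open import Relation.Nullary using (¬_)
open import Relation.Unary using (Pred; _∈_; _⊆_; _≐_; _∪_)
open import Relation.Unary.Polymorphic using (∅)

-- 𝒞-cong makes 𝒞 a function on subsets up to extensional equality _≐_.
record ClosureSpace (c ℓ : Level) : Set (lsuc (c ⊔ ℓ)) where
  field
    Carrier : Set c
    𝒞       : Pred Carrier ℓ → Pred Carrier ℓ
    𝒞-cong  : ∀ {A B} → A ≐ B → 𝒞 A ≐ 𝒞 B
    𝒞-∅     : 𝒞 ∅ ≐ ∅ {ℓ = ℓ}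
    𝒞-ext   : ∀ A → A ⊆ 𝒞 A
    𝒞-∪     : ∀ A B → 𝒞 (A ∪ B) ≐ 𝒞 A ∪ 𝒞 B

module _ {c ℓ : Level} {X : Set c} where

  𝒞[_] : Rel X (c ⊔ ℓ) → Pred X (c ⊔ ℓ) → Pred X (c ⊔ ℓ)
  𝒞[ R ] A = A ∪ (λ x → ∃[ a ] (a ∈ A × R a x))

  fromRel : Rel X (c ⊔ ℓ) → ClosureSpace c (c ⊔ ℓ)
  fromRel R = record
    { Carrier = X
    ; 𝒞       = 𝒞[ R ]
    ; 𝒞-cong  = λ (A⊆B , B⊆A) → mono A⊆B , mono B⊆A
    ; 𝒞-∅     = (λ { (inj₁ ()) ; (inj₂ (_ , () , _)) }) , λ ()
    ; 𝒞-ext   = λ _ → inj₁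
    ; 𝒞-∪     = λ A B →
        (λ { (inj₁ (inj₁ p))           → inj₁ (inj₁ p)
           ; (inj₁ (inj₂ q))           → inj₂ (inj₁ q)
           ; (inj₂ (a , inj₁ p , r))   → inj₁ (inj₂ (a , p , r))
           ; (inj₂ (a , inj₂ q , r))   → inj₂ (inj₂ (a , q , r)) })
      , (λ { (inj₁ p) → mono {A} inj₁ p
           ; (inj₂ q) → mono {B} inj₂ q })
    }
    where
    mono : ∀ {A B} → A ⊆ B → 𝒞[ R ] A ⊆ 𝒞[ R ] B
    mono A⊆B (inj₁ p)           = inj₁ (A⊆B p)
    mono A⊆B (inj₂ (a , p , r)) = inj₂ (a , A⊆B p , r)

QuasiDiscrete : ∀ {c} ℓ → ClosureSpace c (c ⊔ ℓ) → Set (lsuc (c ⊔ ℓ))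
QuasiDiscrete {c} ℓ S =
  Σ[ R ∈ Rel Carrier (c ⊔ ℓ) ] (∀ A → 𝒞 A ≐ 𝒞[_] {c} {ℓ} R A)
  where open ClosureSpace S

image : ∀ {a b ℓ} {A : Set a} {B : Set b} → (A → B) → Pred A ℓ → Pred B (a ⊔ b ⊔ ℓ)
image f P y = ∃[ x ] (x ∈ P × f x ≡ y)

-- The subsets of the target may live in a larger universe than those of the
-- source; Lift only adjusts the universe of the image.
Continuous : ∀ {c₁ ℓ₁ c₂} ℓ₂ (S : ClosureSpace c₁ ℓ₁) (T : ClosureSpace c₂ (c₁ ⊔ c₂ ⊔ ℓ₁ ⊔ ℓ₂)) →
             (ClosureSpace.Carrier S → ClosureSpace.Carrier T) → Set (c₁ ⊔ c₂ ⊔ lsuc ℓ₁ ⊔ ℓ₂)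
Continuous ℓ₂ S T f =
  ∀ A → image f (S.𝒞 A) ⊆ T.𝒞 (λ y → Lift ℓ₂ (y ∈ image f A))
  where
  module S = ClosureSpace S
  module T = ClosureSpace T

_≻_ : Rel ℕ 0ℓ
m ≻ n = n ≡ suc m

ℕ-space : ClosureSpace 0ℓ 0ℓ
ℕ-space = fromRel _≻_

-- Continuity of a path quantifies over Pred ℕ 0ℓ, hence lives in a universe
-- above 0ℓ.  Subsets of the points of a model are taken at a level of at least
-- 1ℓ, so that formulas mentioning paths still denote subsets to which 𝒞
-- applies.  Under excluded middle, Pred ℕ 0ℓ already contains every subset
-- of ℕ up to _≐_.
subsetLevel : Level → Level → Level
subsetLevel c ℓ = lsuc 0ℓ ⊔ c ⊔ ℓ

record QuasiDiscreteModel {ap} (AP : Set ap) (c ℓ : Level) : Set (ap ⊔ lsuc (subsetLevel c ℓ)) where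
  field
    space         : ClosureSpace c (subsetLevel c ℓ)
    quasiDiscrete : QuasiDiscrete (lsuc 0ℓ ⊔ ℓ) space
  open ClosureSpace space public
  field
    𝒱             : AP → Pred Carrier (subsetLevel c ℓ)

  Path : Set (subsetLevel c ℓ)
  Path = Σ[ p ∈ (ℕ → Carrier) ] Continuous (lsuc 0ℓ ⊔ ℓ) ℕ-space space p

infix  30 `¬_ `𝒩_
infixr 25 _`∧_
infix  20 _`𝒮_ _`↝_

data Formula {ap} (AP : Set ap) : Set ap where
  atom : AP → Formula AP
  `⊤   : Formula AP
  `¬_  : Formula AP → Formula AP
  _`∧_ : Formula AP → Formula AP → Formula AP
  `𝒩_  : Formula AP → Formula AP
  _`𝒮_ : Formula AP → Formula AP → Formula AP
  _`↝_ : Formula AP → Formula AP → Formula AP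

module Semantics {ap c ℓ : Level} {AP : Set ap} (M : QuasiDiscreteModel AP c ℓ) where
  open QuasiDiscreteModel M public

  infix 10 _⊨_

  _⊨_ : Carrier → Formula AP → Set (subsetLevel c ℓ)
  x ⊨ atom a   = x ∈ 𝒱 a
  x ⊨ `⊤       = ⊤
  x ⊨ `¬ φ     = ¬ (x ⊨ φ)
  x ⊨ φ `∧ ψ   = (x ⊨ φ) × (x ⊨ ψ)
  x ⊨ `𝒩 φ     = x ∈ 𝒞 (λ y → y ⊨ φ)
  x ⊨ φ₁ `𝒮 φ₂ =
    (x ⊨ φ₁) ×
    (∀ ((p , _) : Path) → p 0 ≡ x → ∀ l → ¬ (p l ⊨ φ₁) →
       ∃[ k ] (0 < k × k ≤ l × (p k ⊨ φ₂)))
  x ⊨ φ₁ `↝ φ₂ =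
    (x ⊨ φ₂) ×
    (∃[ y ] Σ[ (p , _) ∈ Path ] ∃[ l ]
       (p 0 ≡ y × p l ≡ x × (y ⊨ φ₁) × (∀ i → 0 < i → i < l → p i ⊨ φ₂)))

{-# OPTIONS --safe #-}

-- Continuous paths are exactly the sequences in which each step either stays put
-- or follows the generating relation R.  Given A, a path from x stays in A until
-- it first enters 𝒞 A ∖ A, where φ₂ holds.  Conversely, take A to be the points
-- reachable from x by R-steps landing outside φ₂: a point of A violating φ₁ would
-- give a path with no φ₂-point after its origin, and a point of 𝒞 A ∖ A violating
-- φ₂ would itself be reachable.

module Submission where

open import Defs
open import Level using (Level; lift)
open import Axiom.DoubleNegationElimination using (em⇒dne)
open import Axiom.ExcludedMiddle using (ExcludedMiddle)
open import Data.Nat.Base using (ℕ; zero; suc; _<_; _≤_; z≤n; s≤s)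
open import Data.Nat.Properties using (m≤n⇒m≤1+n; ≤-refl)
open import Data.Product using (Σ-syntax; ∃-syntax; _×_; _,_; proj₁; proj₂)
open import Data.Sum using (_⊎_; inj₁; inj₂)
open import Function.Bundles using (_⇔_; mk⇔)
open import Relation.Binary.Construct.Closure.ReflexiveTransitive using (Star; ε; _◅_; _◅◅_)
open import Relation.Binary.Core using (Rel)
open import Relation.Binary.PropositionalEquality using (_≡_; refl; subst; sym)
open import Relation.Nullary using (¬_; yes; no; contradiction)
open import Relation.Unary using (Pred; _∈_; _∖_)

module _ {ap c ℓ : Level} {AP : Set ap} (M : QuasiDiscreteModel AP c ℓ) where
  open Semantics M

  R : Rel Carrier (subsetLevel c ℓ)
  R = proj₁ quasiDiscrete

  Stepwise : (ℕ → Carrier) → Set (subsetLevel c ℓ)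
  Stepwise p = ∀ n → p n ≡ p (suc n) ⊎ R (p n) (p (suc n))

  -- Continuity is tested on the singleton of `n`: its closure contains `suc n`, so `p (suc n)` lies
  -- in the closure of the one point `p n`, that is, equals it or is an `R`-successor.
  path⇒stepwise : ((p , _) : Path) → Stepwise p
  path⇒stepwise (p , cont) n
    with proj₁ (proj₂ quasiDiscrete _) (cont (_≡ n) (suc n , inj₂ (n , refl , refl) , refl))
  ... | inj₁ (lift (_ , refl , eq))         = inj₁ eq
  ... | inj₂ (_ , lift (_ , refl , refl) , r) = inj₂ r

  stepwise⇒path : ∀ {p} → Stepwise p → Path
  stepwise⇒path {p} step = p , cont
    where
    cont : Continuous _ ℕ-space space p
    cont A (n , inj₁ n∈A , refl) = 𝒞-ext _ (lift (n , n∈A , refl))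
    cont A (_ , inj₂ (n , n∈A , refl) , refl) with step n
    ... | inj₁ eq = 𝒞-ext _ (lift (n , n∈A , eq))
    ... | inj₂ r  = proj₂ (proj₂ quasiDiscrete _) (inj₂ (p n , lift (n , n∈A , refl) , r))

  R-step⇒𝒞 : ∀ {A : Pred Carrier (subsetLevel c ℓ)} {a b} → a ∈ A → R a b → b ∈ 𝒞 A
  R-step⇒𝒞 a∈A r = proj₂ (proj₂ quasiDiscrete _) (inj₂ (_ , a∈A , r))

  -- Induction on `l`, keeping the first exit once it is found. A step that stays put cannot leave
  -- `A`, so a step out of `A` follows `R` and lands in `𝒞 A`. Excluded middle decides membership in
  -- the arbitrary subset `A`.
  stepwise-in-or-exits : ExcludedMiddle (subsetLevel c ℓ) →
    ∀ {A : Pred Carrier (subsetLevel c ℓ)} {p} → Stepwise p → p 0 ∈ A →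
    ∀ l → p l ∈ A ⊎ ∃[ k ] (0 < k × k ≤ l × p k ∈ 𝒞 A ∖ A)
  stepwise-in-or-exits em step p0∈A zero = inj₁ p0∈A
  stepwise-in-or-exits em {A} {p} step p0∈A (suc l) with stepwise-in-or-exits em step p0∈A l
  ... | inj₂ (k , 0<k , k≤l , exit) = inj₂ (k , 0<k , m≤n⇒m≤1+n k≤l , exit)
  ... | inj₁ pl∈A with step l
  ...   | inj₁ eq = inj₁ (subst A eq pl∈A)
  ...   | inj₂ r with em {A (p (suc l))}
  ...     | yes q = inj₁ q
  ...     | no ¬q = inj₂ (suc l , s≤s z≤n , ≤-refl , R-step⇒𝒞 pl∈A r , ¬q)

  -- Only the target of a step is constrained, so the origin of a chain may lie outside `P`. This
  -- matches the condition `0 < k` in the semantics of `𝒮`.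
  R-into : Pred Carrier (subsetLevel c ℓ) → Rel Carrier (subsetLevel c ℓ)
  R-into P a b = R a b × P b

  cons : Carrier → (ℕ → Carrier) → ℕ → Carrier
  cons x p zero    = x
  cons x p (suc n) = p n

  -- Each step of the chain is prepended to the path built from the rest. Paths are infinite, so
  -- from index `l` on this one rests at `y`.
  star⇒stepwise : ∀ {P x y} → Star (R-into P) x y →
    ∃[ p ] ∃[ l ] (Stepwise p × p 0 ≡ x × p l ≡ y × (∀ k → 0 < k → k ≤ l → p k ∈ P))
  star⇒stepwise {x = x} ε = (λ _ → x) , 0 , (λ _ → inj₁ refl) , refl , refl , λ { _ () z≤n }
  star⇒stepwise {P} {x} ((r , Pb) ◅ rs) with star⇒stepwise rs
  ... | p , l , step , refl , pl≡y , inP = cons x p , suc l , step′ , refl , pl≡y , inP′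
    where
    step′ : Stepwise (cons x p)
    step′ zero    = inj₂ r
    step′ (suc n) = step n

    inP′ : ∀ k → 0 < k → k ≤ suc l → cons x p k ∈ P
    -- Index 1 is the origin of the tail, about which `inP` says nothing; the prepended step itself
    -- supplies `Pb`.
    inP′ (suc zero)    _ _         = Pb
    inP′ (suc (suc k)) _ (s≤s k≤l) = inP (suc k) (s≤s z≤n) k≤l

theorem3p7 : ∀ {ap c ℓ : Level} {AP : Set ap} →
    ExcludedMiddle (subsetLevel c ℓ) →
    (M : QuasiDiscreteModel AP c ℓ) → let open Semantics M in
    (x : Carrier) (φ₁ φ₂ : Formula AP) →
    (x ⊨ φ₁ `𝒮 φ₂) ⇔
    (Σ[ A ∈ Pred Carrier (subsetLevel c ℓ) ]
    (x ∈ A × (∀ y → y ∈ A → y ⊨ φ₁) × (∀ z → z ∈ 𝒞 A ∖ A → z ⊨ φ₂)))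
theorem3p7 {c = c} {ℓ = ℓ} em M x φ₁ φ₂ = mk⇔ to from
  where
  open Semantics M

  Surrounded : Set _
  Surrounded = Σ[ A ∈ Pred Carrier (subsetLevel c ℓ) ]
    (x ∈ A × (∀ y → y ∈ A → y ⊨ φ₁) × (∀ z → z ∈ 𝒞 A ∖ A → z ⊨ φ₂))

  to : x ⊨ φ₁ `𝒮 φ₂ → Surrounded
  to (_ , escape) = A , ε , inside , boundary
    where
    A : Pred Carrier (subsetLevel c ℓ)
    A = Star (R-into M (_⊨ `¬ φ₂)) x

    inside : ∀ y → y ∈ A → y ⊨ φ₁
    -- `escape` yields information only at a point where `φ₁` fails, hence the argument by
    -- contradiction.
    inside y x↝y = em⇒dne em λ y⊭φ₁ →
      let p , l , step , p0≡x , pl≡y , avoids = star⇒stepwise M x↝y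
          k , 0<k , k≤l , pk⊨φ₂ =
            escape (stepwise⇒path M step) p0≡x l (subst (_⊨ `¬ φ₁) (sym pl≡y) y⊭φ₁)
      in avoids k 0<k k≤l pk⊨φ₂

    boundary : ∀ z → z ∈ 𝒞 A ∖ A → z ⊨ φ₂
    boundary z (z∈𝒞A , z∉A) with proj₁ (proj₂ quasiDiscrete A) z∈𝒞A
    ... | inj₁ z∈A           = contradiction z∈A z∉A
    ... | inj₂ (a , x↝a , r) = em⇒dne em λ z⊭φ₂ → z∉A (x↝a ◅◅ (r , z⊭φ₂) ◅ ε)

  from : Surrounded → x ⊨ φ₁ `𝒮 φ₂
  from (A , x∈A , inside , boundary) = inside x x∈A , escape
    where
    escape : ∀ ((p , _) : Path) → p 0 ≡ x → ∀ l → ¬ (p l ⊨ φ₁) →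
      ∃[ k ] (0 < k × k ≤ l × (p k ⊨ φ₂))
    escape path refl l pl⊭φ₁ with stepwise-in-or-exits M em (path⇒stepwise M path) x∈A l
    ... | inj₁ pl∈A                   = contradiction (inside _ pl∈A) pl⊭φ₁
    ... | inj₂ (k , 0<k , k≤l , exit) = k , 0<k , k≤l , boundary _ exit
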